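{- Let $R(X)$ be interpreted as "$|X|$ is a power of $2$". The relation $EqCard$, as well as the graphs of $+$ and $\times$, are $\{<,R\}$-finite-definable.
   Context: $\mathcal{F}$ denotes the set of finite subsets of $\mathbb{N}$ and $|X|$ the cardinality of $X\in\mathcal{F}$. $EqCard(X,Y)$ is the binary relation on $\mathcal{F}$ which holds iff $|X|=|Y|$. $R$ is a unary relation on $\mathcal{F}$. Formulas of monadic second-order logic (MSO) over $\{<,R\}$ use first-order variables ranging over the domain, monadic second-order variables ranging over subsets of the domain, membership $x\in X$, and the symbols $<$ and $R$ ($R$ takes one monadic second-order argument). For $q\ge 1$, $\mathcal{M}_q=([0,q),<,R)$ is the finite structure with domain $[0,q)=\{0,\dots,q-1\}$, in which $<$ is the usual order restricted to $[0,q)$ and $R$ is restricted to subsets of $[0,q)$. A relation $S\subseteq\mathcal{F}^n$ is $\{<,R\}$-finite-definable if there is a single MSO formula $\varphi(X_1,\dots,X_n)$ over $\{<,R\}$ such that for every $q\ge 1$ the relation defined by $\varphi$ in $\mathcal{M}_q$ is exactly the set of tuples $(X_1,\dots,X_n)\in S$ with $X_i\subseteq[0,q)$ for all $i$. Similarly, a relation $S\subseteq\mathbb{N}^m$ is $\{<,R\}$-finite-definable if there is a single MSO formula $\varphi(x_1,\dots,x_m)$ with first-order free variables such that for every $q\ge1$ the relation defined by $\varphi$ in $\mathcal{M}_q$ is $S\cap[0,q)^m$. The graph of $+$ (resp. $\times$) is $\{(x,y,z)\in\mathbb{N}^3 : x+y=z\}$ (resp. $\{(x,y,z)\in\mathbb{N}^3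 : xy=z\}$). -}

module Defs where

open import Data.Empty using (⊥-elim)
open import Data.Fin as Fin using (Fin; toℕ; fromℕ<)
open import Data.Fin.Properties using (toℕ<n; toℕ-fromℕ<; toℕ-injective)
open import Data.Fin.Subset using (Subset; inside) renaming (_∈_ to _∈ₛ_)
open import Data.Fin.Subset.Properties using (_∈?_; ⊆-antisym)
open import Data.List as List using (List; []; _∷_; length; allFin; filter)
open import Data.List.Membership.Propositional using (_∈_)
open import Data.List.Membership.Propositional.Properties
  using (∈-allFin; ∈-map⁺; ∈-map⁻; ∈-filter⁺; ∈-filter⁻)
open import Data.List.Relation.Unary.All as All using (All)
open import Data.List.Relation.Unary.AllPairs as AllPairs using (AllPairs; []; _∷_)
import Data.List.Relation.Unary.AllPairs.Properties as AllPairsₚ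
open import Data.List.Relation.Unary.Any using (here; there)
open import Data.Nat using (ℕ; suc; _+_; _*_; _^_; _<_; _≥_; _≟_)
open import Data.List.Membership.DecPropositional _≟_ using () renaming (_∈?_ to _∈ₗ?_)
open import Data.Nat.Properties using (<-irrefl; <-asym; <-irrelevant)
open import Data.Product using (Σ; ∃-syntax; _×_; _,_; proj₂)
open import Data.Sum using (_⊎_)
open import Data.Vec as Vec using (Vec; []; _∷_; lookup)
open import Data.Vec.Properties using (lookup∘tabulate; []=⇒lookup; lookup⇒[]=)
open import Function using (_⇔_; id)
open import Relation.Binary.PropositionalEquality
  using (_≡_; refl; sym; trans; cong; subst)
open import Relation.Nullary using (¬_; does; yes; no)

-- A finite subset of ℕ is represented by its strictly increasing enumeration,
-- so that _≡_ on 𝓕 is equality of sets and length is cardinality.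

record 𝓕 : Set where
  constructor mk𝓕
  field
    elements  : List ℕ
    ascending : AllPairs _<_ elements

open 𝓕 public

card : 𝓕 → ℕ
card X = length (elements X)

-- The subset of [0,q) given by X, regarded as an element of 𝓕.

embed : ∀ {q} → Subset q → 𝓕
embed {q} X = mk𝓕
  (List.map toℕ (filter (_∈? X) (allFin q)))
  (AllPairsₚ.map⁺ (AllPairsₚ.filter⁺ (_∈? X) (AllPairsₚ.tabulate⁺-< id)))

-- MSO formulas over {<,R} with k free first-order and l free second-order
-- variables (de Bruijn indices). Equality of first-order variables is not
-- primitive: x = y is expressed by ¬ (x < y) ∧ ¬ (y < x).

infix  9 _≺_ _ε_
infix  8 ~_
infixr 7 _∧_
infixr 6 _∨_
infixr 5 _⇒_

data Formula : ℕ → ℕ → Set where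
  _≺_         : ∀ {k l} → Fin k → Fin k → Formula k l
  _ε_         : ∀ {k l} → Fin k → Fin l → Formula k l
  𝐑           : ∀ {k l} → Fin l → Formula k l
  ~_          : ∀ {k l} → Formula k l → Formula k l
  _∧_ _∨_ _⇒_ : ∀ {k l} → Formula k l → Formula k l → Formula k l
  ∃₁ ∀₁       : ∀ {k l} → Formula (suc k) l → Formula k l
  ∃₂ ∀₂       : ∀ {k l} → Formula k (suc l) → Formula k l

module _ (R : 𝓕 → Set) where

  -- Satisfaction in the structure ([0,q),<,R).

  Sat : ∀ q {k l} → Formula k l → Vec (Fin q) k → Vec (Subset q) l → Set
  Sat q (x ≺ y) xs Xs = lookup xs x Fin.< lookup xs y
  Sat q (x ε X) xs Xs = lookup xs x ∈ₛ lookup Xs X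
  Sat q (𝐑 X)   xs Xs = R (embed (lookup Xs X))
  Sat q (~ φ)   xs Xs = ¬ Sat q φ xs Xs
  Sat q (φ ∧ ψ) xs Xs = Sat q φ xs Xs × Sat q ψ xs Xs
  Sat q (φ ∨ ψ) xs Xs = Sat q φ xs Xs ⊎ Sat q ψ xs Xs
  Sat q (φ ⇒ ψ) xs Xs = Sat q φ xs Xs → Sat q ψ xs Xs
  Sat q (∃₁ φ)  xs Xs = ∃[ x ] Sat q φ (x ∷ xs) Xs
  Sat q (∀₁ φ)  xs Xs = ∀ x → Sat q φ (x ∷ xs) Xs
  Sat q (∃₂ φ)  xs Xs = ∃[ X ] Sat q φ xs (X ∷ Xs)
  Sat q (∀₂ φ)  xs Xs = ∀ X → Sat q φ xs (X ∷ Xs)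

  FiniteDefinable𝓕 : ∀ {n} → (Vec 𝓕 n → Set) → Set
  FiniteDefinable𝓕 {n} S =
    Σ (Formula 0 n) λ φ → ∀ q → q ≥ 1 → (Xs : Vec (Subset q) n) →
      Sat q φ [] Xs ⇔ S (Vec.map embed Xs)

  FiniteDefinableℕ : ∀ {m} → (Vec ℕ m → Set) → Set
  FiniteDefinableℕ {m} S =
    Σ (Formula m 0) λ φ → ∀ q → q ≥ 1 → (xs : Vec (Fin q) m) →
      Sat q φ xs [] ⇔ S (Vec.map toℕ xs)

CardIsPowerOf2 : 𝓕 → Set
CardIsPowerOf2 X = ∃[ k ] card X ≡ 2 ^ k

EqCard : Vec 𝓕 2 → Set
EqCard (X ∷ Y ∷ []) = card X ≡ card Y

+-Graph : Vec ℕ 3 → Set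
+-Graph (x ∷ y ∷ z ∷ []) = x + y ≡ z

×-Graph : Vec ℕ 3 → Set
×-Graph (x ∷ y ∷ z ∷ []) = x * y ≡ z

-- embed identifies Subset q with the elements of 𝓕 contained in [0,q), so
-- quantifying over Vec (Subset q) n in FiniteDefinable𝓕 covers exactly the
-- tuples of elements of 𝓕 contained in [0,q).

∈-embed⁺ : ∀ {q} (X : Subset q) {i} → i ∈ₛ X → toℕ i ∈ elements (embed X)
∈-embed⁺ X {i} i∈X = ∈-map⁺ toℕ (∈-filter⁺ (_∈? X) (∈-allFin i) i∈X)

∈-embed⁻ : ∀ {q} (X : Subset q) {n} → n ∈ elements (embed X) →
           ∃[ i ] i ∈ₛ X × n ≡ toℕ i
∈-embed⁻ {q} X n∈ with i , i∈ , n≡ ← ∈-map⁻ toℕ n∈ =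
  i , proj₂ (∈-filter⁻ (_∈? X) {xs = allFin q} i∈) , n≡

elements-unique : ∀ {xs ys} → AllPairs _<_ xs → AllPairs _<_ ys →
                  (∀ {n} → n ∈ xs → n ∈ ys) → (∀ {n} → n ∈ ys → n ∈ xs) → xs ≡ ys
elements-unique [] [] f g = refl
elements-unique [] (_ ∷ _) f g with () ← g (here refl)
elements-unique (_ ∷ _) [] f g with () ← f (here refl)
elements-unique {x ∷ xs} {y ∷ ys} (x< ∷ xs↗) (y< ∷ ys↗) f g = go x≡y
  where
  x≡y : x ≡ y
  x≡y with f (here refl) | g (here refl)
  ... | here p   | _        = p
  ... | there _  | here p   = sym p
  ... | there x∈ | there y∈ = ⊥-elim (<-asym (All.lookup y< x∈) (All.lookup x< y∈))

  go : x ≡ y → x ∷ xs ≡ y ∷ ys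
  go refl = cong (x ∷_) (elements-unique xs↗ ys↗ f′ g′)
    where
    f′ : ∀ {n} → n ∈ xs → n ∈ ys
    f′ n∈ with f (there n∈)
    ... | here refl = ⊥-elim (<-irrefl refl (All.lookup x< n∈))
    ... | there n∈′ = n∈′
    g′ : ∀ {n} → n ∈ ys → n ∈ xs
    g′ n∈ with g (there n∈)
    ... | here refl = ⊥-elim (<-irrefl refl (All.lookup y< n∈))
    ... | there n∈′ = n∈′

𝓕-ext : ∀ {X Y} → (∀ {n} → n ∈ elements X → n ∈ elements Y) →
        (∀ {n} → n ∈ elements Y → n ∈ elements X) → X ≡ Y
𝓕-ext {mk𝓕 xs p} {mk𝓕 ys r} f g with refl ← elements-unique p r f g =
  cong (mk𝓕 xs) (AllPairs.irrelevant <-irrelevant p r)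

embed-injective : ∀ {q} (X Y : Subset q) → embed X ≡ embed Y → X ≡ Y
embed-injective X Y eq = ⊆-antisym (incl X Y eq) (incl Y X (sym eq))
  where
  incl : ∀ {q} (X Y : Subset q) → embed X ≡ embed Y → ∀ {i} → i ∈ₛ X → i ∈ₛ Y
  incl X Y eq {i} i∈X
    with j , j∈Y , i≡j ← ∈-embed⁻ Y (subst (λ Z → toℕ i ∈ elements Z) eq (∈-embed⁺ X i∈X))
    with refl ← toℕ-injective i≡j = j∈Y

embed-bounded : ∀ {q} (X : Subset q) → All (_< q) (elements (embed X))
embed-bounded X = All.tabulate λ n∈ → bound (∈-embed⁻ X n∈)
  where
  bound : ∀ {n} → (∃[ i ] i ∈ₛ X × n ≡ toℕ i) → n < _
  bound (i , _ , refl) = toℕ<n i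

embed-surjective : ∀ {q} (Y : 𝓕) → All (_< q) (elements Y) → ∃[ X ] embed {q} X ≡ Y
embed-surjective {q} Y Y<q = X , 𝓕-ext to from
  where
  X : Subset q
  X = Vec.tabulate λ i → does (toℕ i ∈ₗ? elements Y)

  ∈X⁻ : ∀ {i} → i ∈ₛ X → toℕ i ∈ elements Y
  ∈X⁻ {i} i∈X with eq ← trans (sym (lookup∘tabulate _ i)) ([]=⇒lookup i∈X)
    with toℕ i ∈ₗ? elements Y | eq
  ... | yes p | _ = p

  ∈X⁺ : ∀ i → toℕ i ∈ elements Y → i ∈ₛ X
  ∈X⁺ i i∈Y = lookup⇒[]= i X (trans (lookup∘tabulate _ i) lem)
    where
    lem : does (toℕ i ∈ₗ? elements Y) ≡ inside
    lem with toℕ i ∈ₗ? elements Y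
    ... | yes _ = refl
    ... | no ¬p = ⊥-elim (¬p i∈Y)

  to : ∀ {n} → n ∈ elements (embed X) → n ∈ elements Y
  to n∈ with i , i∈X , refl ← ∈-embed⁻ X n∈ = ∈X⁻ i∈X

  from : ∀ {n} → n ∈ elements Y → n ∈ elements (embed X)
  from {n} n∈ = subst (_∈ elements (embed X)) (toℕ-fromℕ< n<q)
    (∈-embed⁺ X (∈X⁺ (fromℕ< n<q) (subst (_∈ elements Y) (sym (toℕ-fromℕ< n<q)) n∈)))
    where n<q = All.lookup Y<q n∈

{-# OPTIONS --safe #-}
module Submission where

-- Put A = X ∖ Y and B = Y ∖ X, so that |X| = |Y| iff |A| = |B|. If A and B are
-- nonempty, split A = U ⊎ C and B = V ⊎ D with |U|, |V| the largest powers of 2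
-- below |A| and |B|. Two disjoint R-sets have the same size iff their union is
-- an R-set, so |U| = |V| = 2ᵏ is expressible, and so is |C| < 2ᵏ (no subset of C
-- has size 2ᵏ). Then |C| = |D| iff R(C ∪ Z) ⇔ R(D ∪ Z) for all Z ⊆ U ∪ V: if
-- |C| < |D|, choosing |Z| = 2ᵏ − |C| puts |D ∪ Z| strictly between 2ᵏ and 2ᵏ⁺¹.
--
-- From EqCard, x + y = z says that y ≤ z and [0,x), [y,z) have the same size, and
-- for x > 0, x y = z says that z is a multiple of x and that the set of multiples
-- of x below z has the size of [0,y).

open import Defs
open import Data.Fin as Fin using (Fin; zero; suc; toℕ; fromℕ<)
open import Data.Fin.Induction using (<-wellFounded)
open import Data.Fin.Properties using (toℕ<n; toℕ-fromℕ<)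
open import Data.Fin.Subset
  using (Subset; inside; outside; ∣_∣; _∩_; _∪_; _─_; _⊆_; ⊥) renaming (_∈_ to _∈ₛ_; _∉_ to _∉ₛ_)
open import Data.Fin.Subset.Properties
  using ( _∈?_; ⊆-antisym; ∣⊥∣≡0; ∩-comm; ∩-zeroˡ; x∈p∩q⁺; x∈p∩q⁻; x∈p∪q⁺; x∈p∪q⁻; p∩q⊆p; p∩q⊆q
        ; p─q⊆p; x∈p∧x∉q⇒x∈p─q; ∣p∩q∣≤∣q∣; x∈p⇒∣p-x∣<∣p∣; drop-there )
open import Data.List using (filter; tabulate; allFin; length; applyUpTo)
open import Data.List.Membership.Propositional using (_∈_)
open import Data.List.Membership.Propositional.Properties using (∈-applyUpTo⁺; ∈-applyUpTo⁻)
open import Data.List.Properties using (length-map; length-applyUpTo)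
open import Data.List.Relation.Unary.AllPairs.Properties using (applyUpTo⁺₁)
open import Data.Nat
  using (ℕ; zero; suc; _+_; _∸_; _*_; _^_; _≤_; _<_; z≤n; s≤s; z<s; NonZero; >-nonZero; _≟_; _<?_)
open import Data.Nat.Divisibility
  using (divides; _∣?_; _∣0; ∣-refl; ∣m∣n⇒∣m+n; ∣m+n∣m⇒∣n; >⇒∤)
  renaming (_∣_ to _∥_)
open import Data.Nat.Properties
open import Data.Product using (∃-syntax; _×_; _,_; proj₁; proj₂)
open import Data.Product.Function.NonDependent.Propositional using (_×-⇔_)
open import Data.Sum using (_⊎_; inj₁; inj₂)
open import Data.Sum.Function.Propositional using (_⊎-⇔_)
open import Data.Vec as Vec using (Vec; []; _∷_; here; there; lookup)
open import Data.Vec.Properties using (lookup∘tabulate; []=⇒lookup; lookup⇒[]=)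
open import Function using (_⇔_; mk⇔; _∘_; id; Equivalence)
open import Function.Construct.Composition using (_⇔-∘_)
open import Function.Construct.Identity using (⇔-id)
open import Function.Construct.Symmetry using (⇔-sym)
open import Function.Related.TypeIsomorphisms using (→-cong-⇔; ¬-cong-⇔)
open import Induction.WellFounded using (Acc; acc)
open import Relation.Binary.PropositionalEquality
  using (_≡_; refl; sym; trans; cong; cong₂; subst; subst₂; module ≡-Reasoning)
open import Relation.Nullary using (¬_; does; yes; no; contradiction)
open import Relation.Unary using (Decidable)

open Equivalence using (to; from)

private
  variable
    k l q : ℕ

-- Combinators for chains of equivalences.

infixr 1 _⟫_
_⟫_ : {A B C : Set} → A ⇔ B → B ⇔ C → A ⇔ C
f ⟫ g = g ⇔-∘ f

Π-cong : {A : Set} {P Q : A → Set} → (∀ a → P a ⇔ Q a) → (∀ a → P a) ⇔ (∀ a → Q a)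
Π-cong h = mk⇔ (λ f a → to (h a) (f a)) (λ f a → from (h a) (f a))

∃-cong : {A : Set} {P Q : A → Set} → (∀ a → P a ⇔ Q a) → (∃[ a ] P a) ⇔ (∃[ a ] Q a)
∃-cong h = mk⇔ (λ (a , p) → a , to (h a) p) (λ (a , p) → a , from (h a) p)

subst-⇔ : {A : Set} (P : A → Set) {a b : A} → a ≡ b → P a ⇔ P b
subst-⇔ P refl = ⇔-id _

-- Powers of two

Pow : ℕ → Set
Pow n = ∃[ k ] n ≡ 2 ^ k

pow-double : ∀ {n} → Pow n → Pow (n + n)
pow-double {n} (k , refl) = suc k , cong (2 ^ k +_) (sym (+-identityʳ (2 ^ k)))

-- With n = 2ᵏ, the sum lies strictly between the consecutive powers 2ᵏ and 2ᵏ⁺¹.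
pow-gap : ∀ {n d} → Pow n → 0 < d → d < n → ¬ Pow (n + d)
pow-gap {d = d} (k , refl) 0<d d<n (m , eq) = <-irrefl eq (begin-strict
  2 ^ k + d           <⟨ +-monoʳ-< (2 ^ k) d<n ⟩
  2 ^ k + 2 ^ k       ≡⟨ cong (2 ^ k +_) (+-identityʳ (2 ^ k)) ⟨
  2 ^ suc k           ≤⟨ ^-monoʳ-≤ 2 k<m ⟩
  2 ^ m               ∎)
  where
  open ≤-Reasoning
  k<m : k < m
  k<m = ≰⇒> λ m≤k → <-irrefl refl (begin-strict
    2 ^ k      <⟨ m<m+n (2 ^ k) 0<d ⟩
    2 ^ k + d  ≡⟨ eq ⟩
    2 ^ m      ≤⟨ ^-monoʳ-≤ 2 m≤k ⟩
    2 ^ k      ∎)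

pow>0 : ∀ {n} → Pow n → 0 < n
pow>0 (k , refl) = m^n>0 2 k

-- If the summands differed, the smaller one, being positive, would put the sum into the gap above
-- the larger one.
pow-sum : ∀ {m n} → Pow m → Pow n → Pow (m + n) → m ≡ n
pow-sum {m} {n} pm pn pmn = ≤-antisym
  (≮⇒≥ λ n<m → pow-gap pm (pow>0 pn) n<m pmn)
  (≮⇒≥ λ m<n → pow-gap pn (pow>0 pm) m<n (subst Pow (+-comm m n) pmn))

-- Induction on n: the power p is kept until the argument reaches p + p, which then takes its place.
pow-floor : ∀ n → 0 < n → ∃[ p ] Pow p × p ≤ n × n < p + p
pow-floor (suc zero) _ = 1 , (0 , refl) , ≤-refl , s≤s (s≤s z≤n)
pow-floor (suc n@(suc _)) _ with p , pp , p≤n , n<2p ← pow-floor n z<s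
  with m≤n⇒m<n∨m≡n n<2p
... | inj₁ 1+n<2p = p , pp , m≤n⇒m≤1+n p≤n , 1+n<2p
... | inj₂ 1+n≡2p = suc n , subst Pow (sym 1+n≡2p) (pow-double pp) , ≤-refl , m<m+n (suc n) z<s

-- u, v, c, d are the sizes of U, V, C, D. The second component expresses c < u,
-- the third compares c and d by adding n further points.

HalfMatching : (u v c d : ℕ) → Set
HalfMatching u v c d =
    Pow u
  × (∀ n → n ≤ c → Pow n → ¬ Pow (u + n))
  × (∀ n → n ≤ u + v → Pow (c + n) → Pow (d + n))

-- If u ≤ c, the second component applies to n = u, yet u + u is a power of 2.
halfMatching⇒< : ∀ {u v c d} → HalfMatching u v c d → c < u
halfMatching⇒< {u} (pu , small , _) = ≰⇒> λ u≤c → small u u≤c pu (pow-double pu)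

-- If c < d, take n = u - c: then c + n = u is a power of 2, while d + n = u + (d - c) falls into
-- the gap above u because d - c ≤ d < u.
halfMatching⇒≤ : ∀ {u v c d} → HalfMatching u v c d → d < u → d ≤ c
halfMatching⇒≤ {u} {v} {c} {d} h@(pu , _ , transfer) d<u = ≮⇒≥ λ c<d →
  pow-gap pu (m<n⇒0<n∸m c<d) (≤-<-trans (m∸n≤m d c) d<u)
    (subst Pow (shift (<⇒≤ c<d)) (transfer (u ∸ c) (≤-trans (m∸n≤m u c) (m≤m+n u v))
      (subst Pow (sym (m+[n∸m]≡n c≤u)) pu)))
  where
  c≤u = <⇒≤ (halfMatching⇒< h)
  shift : c ≤ d → d + (u ∸ c) ≡ u + (d ∸ c)
  shift c≤d = begin
    d + (u ∸ c)  ≡⟨ +-∸-assoc d c≤u ⟨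
    d + u ∸ c    ≡⟨ cong (_∸ c) (+-comm d u) ⟩
    u + d ∸ c    ≡⟨ +-∸-assoc u c≤d ⟩
    u + (d ∸ c)  ∎
    where open ≡-Reasoning

-- Once `pow-sum` has identified u and v, each half matching supplies the strict bound that the
-- other needs for its inequality between c and d.
matching⇒≡ : ∀ {u v c d} → Pow (u + v) → HalfMatching u v c d → HalfMatching v u d c →
             u ≡ v × c ≡ d
matching⇒≡ puv h h′ with refl ← pow-sum (proj₁ h) (proj₁ h′) puv =
  refl , ≤-antisym (halfMatching⇒≤ h′ (halfMatching⇒< h)) (halfMatching⇒≤ h (halfMatching⇒< h′))

halfMatching-diagonal : ∀ {u v c} → Pow u → c < u → HalfMatching u v c c
halfMatching-diagonal pu c<u =
  pu , (λ n n≤c pn → pow-gap pu (pow>0 pn) (≤-<-trans n≤c c<u)) , λ _ _ → id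

-- Cardinalities of subsets

Disjoint : Subset q → Subset q → Set
Disjoint p r = ∀ {i} → i ∈ₛ p → i ∉ₛ r

x∈p─q⇒x∉q : ∀ (p r : Subset q) → Disjoint (p ─ r) r
x∈p─q⇒x∉q (_ ∷ p) (outside ∷ r) (there x∈) (there x∈r) = x∈p─q⇒x∉q p r x∈ x∈r
x∈p─q⇒x∉q (_ ∷ p) (inside  ∷ r) (there x∈) (there x∈r) = x∈p─q⇒x∉q p r x∈ x∈r

disjoint-∪ : {p r s : Subset q} → Disjoint p r → Disjoint p s → Disjoint p (r ∪ s)
disjoint-∪ {r = r} {s} p#r p#s i∈p i∈ with x∈p∪q⁻ r s i∈
... | inj₁ i∈r = p#r i∈p i∈r
... | inj₂ i∈s = p#s i∈p i∈s

disjoint-⊆ : {p p′ r r′ : Subset q} → p ⊆ p′ → r ⊆ r′ → Disjoint p′ r′ → Disjoint p r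
disjoint-⊆ p⊆ r⊆ p#r i∈p i∈r = p#r (p⊆ i∈p) (r⊆ i∈r)

disjoint-sym : {p r : Subset q} → Disjoint p r → Disjoint r p
disjoint-sym p#r i∈r i∈p = p#r i∈p i∈r

∣p∪q∣≡∣p∣+∣q∣ : (p r : Subset q) → Disjoint p r → ∣ p ∪ r ∣ ≡ ∣ p ∣ + ∣ r ∣
∣p∪q∣≡∣p∣+∣q∣ [] [] _ = refl
∣p∪q∣≡∣p∣+∣q∣ (outside ∷ p) (outside ∷ r) p#r =
  ∣p∪q∣≡∣p∣+∣q∣ p r λ i∈p i∈r → p#r (there i∈p) (there i∈r)
∣p∪q∣≡∣p∣+∣q∣ (outside ∷ p) (inside ∷ r) p#r =
  trans (cong suc (∣p∪q∣≡∣p∣+∣q∣ p r λ i∈p i∈r → p#r (there i∈p) (there i∈r)))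
        (sym (+-suc ∣ p ∣ ∣ r ∣))
∣p∪q∣≡∣p∣+∣q∣ (inside ∷ p) (outside ∷ r) p#r =
  cong suc (∣p∪q∣≡∣p∣+∣q∣ p r λ i∈p i∈r → p#r (there i∈p) (there i∈r))
∣p∪q∣≡∣p∣+∣q∣ (inside ∷ p) (inside ∷ r) p#r = contradiction here (p#r here)

∣p∩q∣+∣q─p∣≡∣q∣ : (p r : Subset q) → ∣ p ∩ r ∣ + ∣ r ─ p ∣ ≡ ∣ r ∣
∣p∩q∣+∣q─p∣≡∣q∣ [] [] = refl
∣p∩q∣+∣q─p∣≡∣q∣ (outside ∷ p) (outside ∷ r) = ∣p∩q∣+∣q─p∣≡∣q∣ p r
∣p∩q∣+∣q─p∣≡∣q∣ (outside ∷ p) (inside  ∷ r) =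
  trans (+-suc ∣ p ∩ r ∣ ∣ r ─ p ∣) (cong suc (∣p∩q∣+∣q─p∣≡∣q∣ p r))
∣p∩q∣+∣q─p∣≡∣q∣ (inside  ∷ p) (outside ∷ r) = ∣p∩q∣+∣q─p∣≡∣q∣ p r
∣p∩q∣+∣q─p∣≡∣q∣ (inside  ∷ p) (inside  ∷ r) = cong suc (∣p∩q∣+∣q─p∣≡∣q∣ p r)

-- The common summand `∣ p ∩ r ∣` cancels; this reduces the problem to disjoint sets.
∣p∣≡∣q∣⇔∣p─q∣≡∣q─p∣ : (p r : Subset q) → ∣ p ∣ ≡ ∣ r ∣ ⇔ ∣ p ─ r ∣ ≡ ∣ r ─ p ∣
∣p∣≡∣q∣⇔∣p─q∣≡∣q─p∣ p r = mk⇔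
  (λ eq → +-cancelˡ-≡ ∣ p ∩ r ∣ _ _ (trans p-split (trans eq (sym (∣p∩q∣+∣q─p∣≡∣q∣ p r)))))
  (λ eq → trans (sym p-split) (trans (cong (∣ p ∩ r ∣ +_) eq) (∣p∩q∣+∣q─p∣≡∣q∣ p r)))
  where
  p-split : ∣ p ∩ r ∣ + ∣ p ─ r ∣ ≡ ∣ p ∣
  p-split = trans (cong (λ s → ∣ s ∣ + ∣ p ─ r ∣) (∩-comm p r)) (∣p∩q∣+∣q─p∣≡∣q∣ r p)

∣p∣≡0⇒x∉p : {p : Subset q} → ∣ p ∣ ≡ 0 → ∀ {i} → i ∉ₛ p
∣p∣≡0⇒x∉p eq i∈p = n≮0 (≤-trans (x∈p⇒∣p-x∣<∣p∣ i∈p) (≤-reflexive eq))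

p─q-empty⇒p⊆q : (p r : Subset q) → ∣ p ─ r ∣ ≡ 0 → p ⊆ r
p─q-empty⇒p⊆q p r eq {i} i∈p with i ∈? r
... | yes i∈r = i∈r
... | no  i∉r = contradiction (x∈p∧x∉q⇒x∈p─q i∈p i∉r) (∣p∣≡0⇒x∉p eq)

subset-of-size : (p : Subset q) → ∀ {n} → n ≤ ∣ p ∣ → ∃[ w ] ∣ w ∩ p ∣ ≡ n
subset-of-size {q} p {zero} _ = ⊥ , trans (cong ∣_∣ (∩-zeroˡ p)) (∣⊥∣≡0 q)
subset-of-size (outside ∷ p) {suc n} n≤ with w , eq ← subset-of-size p n≤ = outside ∷ w , eq
subset-of-size (inside ∷ p) {suc n} (s≤s n≤) with w , eq ← subset-of-size p n≤ = inside ∷ w , cong suc eq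

-- As w varies, `∣ w ∩ E ∣` takes exactly the values 0, ..., `∣ E ∣`. This turns set quantifiers of
-- formulas into the numerical quantifiers of `HalfMatching`; intersecting with E avoids a clause
-- for inclusion.
∀-sizes : (E : Subset q) (P : ℕ → Set) → (∀ w → P ∣ w ∩ E ∣) ⇔ (∀ n → n ≤ ∣ E ∣ → P n)
∀-sizes E P = mk⇔
  (λ h n n≤ → let w , eq = subset-of-size E n≤ in subst P eq (h w))
  (λ h w → h _ (∣p∩q∣≤∣q∣ w E))

-- Comprehension and counting by enumeration.

comprehension : {P : Fin q → Set} → Decidable P → Subset q
comprehension P? = Vec.tabulate (does ∘ P?)

∈-comprehension : {P : Fin q → Set} (P? : Decidable P) → ∀ i → i ∈ₛ comprehension P? ⇔ P i
∈-comprehension {P = P} P? i = mk⇔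
  (λ i∈ → fwd (trans (sym (lookup∘tabulate (does ∘ P?) i)) ([]=⇒lookup i∈)))
  (λ p → lookup⇒[]= i _ (trans (lookup∘tabulate (does ∘ P?) i) (bwd p)))
  where
  fwd : does (P? i) ≡ inside → P i
  fwd eq with P? i
  ... | yes p = p
  bwd : P i → does (P? i) ≡ inside
  bwd p with P? i
  ... | yes _ = refl
  ... | no ¬p = contradiction p ¬p

card-embed : (X : Subset q) → card (embed X) ≡ ∣ X ∣
card-embed {q} X = trans (length-map toℕ (filter (_∈? X) (allFin q))) (count X id λ _ → mk⇔ id id)
  where
  -- X stays fixed in the filter, so the induction runs over Y, the preimage of X under f.
  count : ∀ {n} (Y : Subset n) (f : Fin n → Fin q) → (∀ i → f i ∈ₛ X ⇔ i ∈ₛ Y) →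
          length (filter (_∈? X) (tabulate f)) ≡ ∣ Y ∣
  count [] f h = refl
  count (inside ∷ Y) f h with f zero ∈? X
  ... | yes _ = cong suc (count Y (f ∘ suc) λ i → mk⇔ (drop-there ∘ to (h (suc i))) (from (h (suc i)) ∘ there))
  ... | no ∉X = contradiction (from (h zero) here) ∉X
  count (outside ∷ Y) f h with f zero ∈? X
  ... | yes ∈X with () ← to (h zero) ∈X
  ... | no _ = count Y (f ∘ suc) λ i → mk⇔ (drop-there ∘ to (h (suc i))) (from (h (suc i)) ∘ there)

-- The list f 0, ..., f (n - 1) and the elements of `embed X` are both strictly increasing with the
-- same members, hence equal. The bound by q makes every f j a point of the domain.
∣∣-enumeration : (X : Subset q) (n : ℕ) (f : ℕ → ℕ) →
  (∀ {i j} → i < j → f i < f j) → (∀ {j} → j < n → f j < q) →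
  (∀ i → i ∈ₛ X ⇔ (∃[ j ] j < n × toℕ i ≡ f j)) → ∣ X ∣ ≡ n
∣∣-enumeration X n f f-mono f<q h = begin
  ∣ X ∣                          ≡⟨ card-embed X ⟨
  length (elements (embed X))    ≡⟨ cong length (elements-unique (ascending (embed X))
                                      (applyUpTo⁺₁ f n λ i<j _ → f-mono i<j) forth back) ⟩
  length (applyUpTo f n)         ≡⟨ length-applyUpTo f n ⟩
  n                              ∎
  where
  open ≡-Reasoning
  forth : ∀ {m} → m ∈ elements (embed X) → m ∈ applyUpTo f n
  forth m∈ with i , i∈X , refl ← ∈-embed⁻ X m∈ with j , j<n , eq ← to (h i) i∈X =
    subst (_∈ applyUpTo f n) (sym eq) (∈-applyUpTo⁺ f j<n)
  back : ∀ {m} → m ∈ applyUpTo f n → m ∈ elements (embed X)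
  back m∈ with j , j<n , refl ← ∈-applyUpTo⁻ f m∈ =
    subst (_∈ elements (embed X)) (toℕ-fromℕ< (f<q j<n))
      (∈-embed⁺ X (from (h _) (j , j<n , toℕ-fromℕ< (f<q j<n))))

ext-⇔ : (X Y : Subset q) → (∀ i → (i ∈ₛ X → i ∈ₛ Y) × (i ∈ₛ Y → i ∈ₛ X)) ⇔ X ≡ Y
ext-⇔ X Y = mk⇔ (λ h → ⊆-antisym (λ {i} → proj₁ (h i)) (λ {i} → proj₂ (h i)))
                (λ { refl i → id , id })

∈-∪-⇔ : (p r : Subset q) → ∀ {i} → (i ∈ₛ p ⊎ i ∈ₛ r) ⇔ i ∈ₛ p ∪ r
∈-∪-⇔ p r = mk⇔ x∈p∪q⁺ (x∈p∪q⁻ p r)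

∈-∩-⇔ : (p r : Subset q) → ∀ {i} → (i ∈ₛ p × i ∈ₛ r) ⇔ i ∈ₛ p ∩ r
∈-∩-⇔ p r = mk⇔ x∈p∩q⁺ (x∈p∩q⁻ p r)

∈-─-⇔ : (p r : Subset q) → ∀ {i} → (i ∈ₛ p × i ∉ₛ r) ⇔ i ∈ₛ p ─ r
∈-─-⇔ p r = mk⇔ (λ (i∈p , i∉r) → x∈p∧x∉q⇒x∈p─q i∈p i∉r)
                (λ i∈ → p─q⊆p p r i∈ , x∈p─q⇒x∉q p r i∈)

-- Initial segments and intervals.

initial : Fin q → Subset q
initial x = comprehension (Fin._<? x)

∈-initial : (x : Fin q) → ∀ i → i ∈ₛ initial x ⇔ i Fin.< x
∈-initial x = ∈-comprehension (Fin._<? x)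

∣initial∣ : (x : Fin q) → ∣ initial x ∣ ≡ toℕ x
∣initial∣ x = ∣∣-enumeration _ (toℕ x) id id (λ j<x → <-trans j<x (toℕ<n x)) λ i →
  ∈-initial x i ⟫ mk⇔ (λ i<x → toℕ i , i<x , refl) (λ { (_ , j<x , refl) → j<x })

∣initial─initial∣ : (y z : Fin q) → toℕ y ≤ toℕ z →
                ∣ initial z ─ initial y ∣ ≡ toℕ z ∸ toℕ y
∣initial─initial∣ y z y≤z =
  ∣∣-enumeration _ (toℕ z ∸ toℕ y) (toℕ y +_) (+-monoʳ-< (toℕ y))
    (λ j< → <-trans (bound j<) (toℕ<n z)) λ i →
    ⇔-sym (∈-─-⇔ (initial z) (initial y))
    ⟫ (∈-initial z i ×-⇔ ¬-cong-⇔ (∈-initial y i))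
    ⟫ mk⇔ (λ (i<z , i≮y) → toℕ i ∸ toℕ y , ∸-monoˡ-< i<z (≮⇒≥ i≮y) , sym (m+[n∸m]≡n (≮⇒≥ i≮y)))
          (λ (j , j< , eq) → subst (_< toℕ z) (sym eq) (bound j<)
                           , λ i<y → <⇒≱ i<y (subst (toℕ y ≤_) (sym eq) (m≤m+n (toℕ y) j)))
  where
  bound : ∀ {j} → j < toℕ z ∸ toℕ y → toℕ y + j < toℕ z
  bound j< = subst (_ <_) (m+[n∸m]≡n y≤z) (+-monoʳ-< (toℕ y) j<)

-- The sets p and r are arbitrary; only their traces U and V on the two differences count, and C and
-- D are what remains of the differences. The two half matchings give the two inequalities between c
-- and d.
Matching : Subset q → Subset q → Subset q → Subset q → Set
Matching p r x y =
  Pow (u + v) × HalfMatching u v c d × HalfMatching v u d c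
  where
  u = ∣ p ∩ (x ─ y) ∣
  v = ∣ r ∩ (y ─ x) ∣
  c = ∣ (x ─ y) ─ p ∣
  d = ∣ (y ─ x) ─ r ∣

matching⇔∣∣≡ : (x y : Subset q) → (x ≡ y ⊎ (∃[ p ] ∃[ r ] Matching p r x y)) ⇔ ∣ x ∣ ≡ ∣ y ∣
matching⇔∣∣≡ x y = mk⇔ sound complete
  where
  sound : (x ≡ y ⊎ (∃[ p ] ∃[ r ] Matching p r x y)) → ∣ x ∣ ≡ ∣ y ∣
  sound (inj₁ refl) = refl
  sound (inj₂ (p , r , pow , h , h′)) with u≡v , c≡d ← matching⇒≡ pow h h′ =
    from (∣p∣≡∣q∣⇔∣p─q∣≡∣q─p∣ x y)
      (trans (sym (∣p∩q∣+∣q─p∣≡∣q∣ p (x ─ y)))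
        (trans (cong₂ _+_ u≡v c≡d) (∣p∩q∣+∣q─p∣≡∣q∣ r (y ─ x))))

  complete : ∣ x ∣ ≡ ∣ y ∣ → (x ≡ y ⊎ (∃[ p ] ∃[ r ] Matching p r x y))
  complete ∣x∣≡∣y∣ with a≡b ← to (∣p∣≡∣q∣⇔∣p─q∣≡∣q─p∣ x y) ∣x∣≡∣y∣ | ∣ x ─ y ∣ ≟ 0
  ... | yes a≡0 = inj₁ (⊆-antisym (p─q-empty⇒p⊆q x y a≡0) (p─q-empty⇒p⊆q y x (trans (sym a≡b) a≡0)))
  ... | no  a≢0
    -- The same m serves both differences, since they have equal size; a < 2m will give c < m.
    with m , pm , m≤a , a<2m ← pow-floor ∣ x ─ y ∣ (n≢0⇒n>0 a≢0)
    with p , u≡m ← subset-of-size (x ─ y) m≤a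
    with r , v≡m ← subset-of-size (y ─ x) (subst (m ≤_) a≡b m≤a) =
    inj₂ (p , r , matching u≡m v≡m c≡d c<m)
    where
    c≡d : ∣ (x ─ y) ─ p ∣ ≡ ∣ (y ─ x) ─ r ∣
    c≡d = +-cancelˡ-≡ m _ _ (begin
      m + ∣ (x ─ y) ─ p ∣                ≡⟨ cong (_+ _) u≡m ⟨
      ∣ p ∩ (x ─ y) ∣ + ∣ (x ─ y) ─ p ∣  ≡⟨ ∣p∩q∣+∣q─p∣≡∣q∣ p (x ─ y) ⟩
      ∣ x ─ y ∣                          ≡⟨ a≡b ⟩
      ∣ y ─ x ∣                          ≡⟨ ∣p∩q∣+∣q─p∣≡∣q∣ r (y ─ x) ⟨
      ∣ r ∩ (y ─ x) ∣ + ∣ (y ─ x) ─ r ∣  ≡⟨ cong (_+ _) v≡m ⟩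
      m + ∣ (y ─ x) ─ r ∣                ∎)
      where open ≡-Reasoning
    c<m : ∣ (x ─ y) ─ p ∣ < m
    c<m = +-cancelˡ-< m _ _ (subst (_< m + m)
      (trans (sym (∣p∩q∣+∣q─p∣≡∣q∣ p (x ─ y))) (cong (_+ _) u≡m)) a<2m)
    -- The sizes are generalised to variables so that the equations can be matched with `refl`.
    matching : ∀ {u v c d} → u ≡ m → v ≡ m → c ≡ d → c < m →
               Pow (u + v) × HalfMatching u v c d × HalfMatching v u d c
    matching refl refl refl c<m =
      pow-double pm , halfMatching-diagonal pm c<m , halfMatching-diagonal pm c<m

-- Set terms and derived formulas

-- Terms are a notation for definable sets, eliminated by `letₛ`; `below x` stands for [0,x).
data Term (k l : ℕ) : Set where
  var         : Fin l → Term k l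
  below       : Fin k → Term k l
  _⋃_ _⋂_ _∖_ : Term k l → Term k l → Term k l

⟦_⟧ : Term k l → Vec (Fin q) k → Vec (Subset q) l → Subset q
⟦ var X ⟧   xs Xs = lookup Xs X
⟦ below x ⟧ xs Xs = initial (lookup xs x)
⟦ s ⋃ t ⟧   xs Xs = ⟦ s ⟧ xs Xs ∪ ⟦ t ⟧ xs Xs
⟦ s ⋂ t ⟧   xs Xs = ⟦ s ⟧ xs Xs ∩ ⟦ t ⟧ xs Xs
⟦ s ∖ t ⟧   xs Xs = ⟦ s ⟧ xs Xs ─ ⟦ t ⟧ xs Xs

-- "the newest first-order variable lies in t", read below one further
-- second-order binder, as needed in letₛ.
∈ᵗ : Term k l → Formula (suc k) (suc l)
∈ᵗ (var X)   = zero ε suc X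
∈ᵗ (below x) = zero ≺ suc x
∈ᵗ (s ⋃ t)   = ∈ᵗ s ∨ ∈ᵗ t
∈ᵗ (s ⋂ t)   = ∈ᵗ s ∧ ∈ᵗ t
∈ᵗ (s ∖ t)   = ∈ᵗ s ∧ ~ ∈ᵗ t

infixr 4 _⟺_
_⟺_ : Formula k l → Formula k l → Formula k l
φ ⟺ ψ = (φ ⇒ ψ) ∧ (ψ ⇒ φ)

-- MSO has no set terms, so the value of `t` is bound to a new set variable constrained
-- extensionally; exactly one set qualifies.
letₛ : Term k l → Formula k (suc l) → Formula k l
letₛ t φ = ∃₂ (∀₁ (zero ε zero ⟺ ∈ᵗ t) ∧ φ)

isPow : Term k l → Formula k l
isPow t = letₛ t (𝐑 zero)

part rest : (P X Y : Fin l) → Term k l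
part P X Y = var P ⋂ (var X ∖ var Y)
rest P X Y = (var X ∖ var Y) ∖ var P

-- For disjoint u and c with u an R-set, a subset of c that is an R-set and whose union with u is
-- one has the size of u, by `pow-sum`. Excluding this bounds the size of c by that of u.
notDoubled : (u c : Term k (suc l)) → Formula k l
notDoubled u c = ∀₂ (isPow (var zero ⋂ c) ⇒ ~ isPow (u ⋃ (var zero ⋂ c)))

-- One implication suffices here: the half matching with the roles exchanged supplies the converse.
transfers : (c d e : Term k (suc l)) → Formula k l
transfers c d e = ∀₂ (isPow (c ⋃ (var zero ⋂ e)) ⇒ isPow (d ⋃ (var zero ⋂ e)))

halfMatching : (P Q X Y : Fin l) → Formula k l
halfMatching P Q X Y =
    isPow (part P X Y)
  ∧ notDoubled (part (suc P) (suc X) (suc Y)) (rest (suc P) (suc X) (suc Y))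
  ∧ transfers (rest (suc P) (suc X) (suc Y)) (rest (suc Q) (suc Y) (suc X))
              (part (suc P) (suc X) (suc Y) ⋃ part (suc Q) (suc Y) (suc X))

-- The empty set is not an R-set, so empty differences, that is X = Y, need a disjunct of their own.
eqCard : (X Y : Fin l) → Formula k l
eqCard X Y =
    ∀₁ (zero ε X ⟺ zero ε Y)
  ∨ ∃₂ (∃₂ ( isPow (part P (suc (suc X)) (suc (suc Y)) ⋃ part Q (suc (suc Y)) (suc (suc X)))
           ∧ halfMatching P Q (suc (suc X)) (suc (suc Y))
           ∧ halfMatching Q P (suc (suc Y)) (suc (suc X))))
  where
  P = suc zero
  Q = zero

eqCardᵗ : Term k l → Term k (suc l) → Formula k l
eqCardᵗ s t = letₛ s (letₛ t (eqCard (suc zero) zero))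

-- Without the first conjunct, x = 0 and z < y would be accepted, since [y,z) is then empty.
add : (x y z : Fin k) → Formula k l
add x y z = ~ (z ≺ y) ∧ eqCardᵗ (below x) (below z ∖ below y)

isZero : Fin k → Formula k l
isZero x = ∀₁ (~ (zero ≺ suc x))

-- A recursive description: below x only 0 belongs to S, and i belongs iff i + x does, whenever i +
-- x is still in the domain.
isMultiples : Fin k → Fin l → Formula k l
isMultiples x S =
    ∀₁ (zero ≺ suc x ⇒ (zero ε S ⟺ isZero zero))
  ∧ ∀₁ (∀₁ (add (suc zero) (suc (suc x)) zero ⇒ (suc zero ε S ⟺ zero ε S)))

-- For x = 0 the recursion in `isMultiples` says nothing about the set, hence the separate disjunct.
mul : (x y z : Fin k) → Formula k l
mul x y z =
    isZero x ∧ isZero z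
  ∨ ~ isZero x ∧ ∃₂ ( isMultiples x zero ∧ z ε zero
                    ∧ eqCardᵗ (var zero ⋂ below z) (below y))

-- Semantics of the derived formulas

Holds : Formula k l → Vec (Fin q) k → Vec (Subset q) l → Set
Holds {q = q} = Sat CardIsPowerOf2 q

∈ᵗ-sat : (t : Term k l) (i : Fin q) (T : Subset q) → ∀ xs Xs →
         Holds (∈ᵗ t) (i ∷ xs) (T ∷ Xs) ⇔ i ∈ₛ ⟦ t ⟧ xs Xs
∈ᵗ-sat (var X)   i T xs Xs = ⇔-id _
∈ᵗ-sat (below x) i T xs Xs = ⇔-sym (∈-initial (lookup xs x) i)
∈ᵗ-sat (s ⋃ t)   i T xs Xs =
  (∈ᵗ-sat s i T xs Xs ⊎-⇔ ∈ᵗ-sat t i T xs Xs) ⟫ ∈-∪-⇔ (⟦ s ⟧ xs Xs) (⟦ t ⟧ xs Xs)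
∈ᵗ-sat (s ⋂ t)   i T xs Xs =
  (∈ᵗ-sat s i T xs Xs ×-⇔ ∈ᵗ-sat t i T xs Xs) ⟫ ∈-∩-⇔ (⟦ s ⟧ xs Xs) (⟦ t ⟧ xs Xs)
∈ᵗ-sat (s ∖ t)   i T xs Xs =
  (∈ᵗ-sat s i T xs Xs ×-⇔ ¬-cong-⇔ (∈ᵗ-sat t i T xs Xs)) ⟫ ∈-─-⇔ (⟦ s ⟧ xs Xs) (⟦ t ⟧ xs Xs)

letₛ-sat : (t : Term k l) (φ : Formula k (suc l)) (xs : Vec (Fin q) k) (Xs : Vec (Subset q) l) →
           Holds (letₛ t φ) xs Xs ⇔ Holds φ xs (⟦ t ⟧ xs Xs ∷ Xs)
letₛ-sat t φ xs Xs = mk⇔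
  (λ (T , h , s) → subst (λ T → Holds φ xs (T ∷ Xs))
    (⊆-antisym (λ {i} i∈T → to (∈ᵗ-sat t i T xs Xs) (proj₁ (h i) i∈T))
               (λ {i} i∈t → proj₂ (h i) (from (∈ᵗ-sat t i T xs Xs) i∈t))) s)
  (λ s → _ , (λ i → from (∈ᵗ-sat t i _ xs Xs) , to (∈ᵗ-sat t i _ xs Xs)) , s)

isPow-sat : (t : Term k l) (xs : Vec (Fin q) k) (Xs : Vec (Subset q) l) →
            Holds (isPow t) xs Xs ⇔ Pow ∣ ⟦ t ⟧ xs Xs ∣
isPow-sat t xs Xs = letₛ-sat t (𝐑 zero) xs Xs ⟫ subst-⇔ Pow (card-embed (⟦ t ⟧ xs Xs))

notDoubled-sat : (u c : Term k (suc l)) (xs : Vec (Fin q) k) (Xs : Vec (Subset q) l) →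
  Holds (notDoubled u c) xs Xs ⇔
  (∀ W → let ⟦_⟧ᵂ = λ t → ⟦ t ⟧ xs (W ∷ Xs) in
         Pow (∣ W ∩ ⟦ c ⟧ᵂ ∣) → ¬ Pow (∣ ⟦ u ⟧ᵂ ∪ (W ∩ ⟦ c ⟧ᵂ) ∣))
notDoubled-sat u c xs Xs = Π-cong λ W →
  →-cong-⇔ (isPow-sat (var zero ⋂ c) xs (W ∷ Xs))
           (¬-cong-⇔ (isPow-sat (u ⋃ (var zero ⋂ c)) xs (W ∷ Xs)))

transfers-sat : (c d e : Term k (suc l)) (xs : Vec (Fin q) k) (Xs : Vec (Subset q) l) →
  Holds (transfers c d e) xs Xs ⇔
  (∀ W → let ⟦_⟧ᵂ = λ t → ⟦ t ⟧ xs (W ∷ Xs) in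
         Pow (∣ ⟦ c ⟧ᵂ ∪ (W ∩ ⟦ e ⟧ᵂ) ∣) → Pow (∣ ⟦ d ⟧ᵂ ∪ (W ∩ ⟦ e ⟧ᵂ) ∣))
transfers-sat c d e xs Xs = Π-cong λ W →
  →-cong-⇔ (isPow-sat (c ⋃ (var zero ⋂ e)) xs (W ∷ Xs))
           (isPow-sat (d ⋃ (var zero ⋂ e)) xs (W ∷ Xs))

-- Correctness of the formula for equal cardinality.

module _ (xs : Vec (Fin q) k) (Xs : Vec (Subset q) l) (P Q X Y : Fin l) where
  private
    p = lookup Xs P
    r = lookup Xs Q
    x = lookup Xs X
    y = lookup Xs Y

    U = p ∩ (x ─ y)
    V = r ∩ (y ─ x)
    C = (x ─ y) ─ p
    D = (y ─ x) ─ r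

    A#B : Disjoint (x ─ y) (y ─ x)
    A#B i∈A i∈B = x∈p─q⇒x∉q x y i∈A (p─q⊆p y x i∈B)

    U⊆A : U ⊆ x ─ y
    U⊆A = p∩q⊆q p (x ─ y)

    V⊆B : V ⊆ y ─ x
    V⊆B = p∩q⊆q r (y ─ x)

    C⊆A : C ⊆ x ─ y
    C⊆A = p─q⊆p (x ─ y) p

    D⊆B : D ⊆ y ─ x
    D⊆B = p─q⊆p (y ─ x) r

    U#C : Disjoint U C
    U#C i∈U i∈C = x∈p─q⇒x∉q (x ─ y) p i∈C (p∩q⊆p p (x ─ y) i∈U)

    V#D : Disjoint V D
    V#D i∈V i∈D = x∈p─q⇒x∉q (y ─ x) r i∈D (p∩q⊆p r (y ─ x) i∈V)

    U#V : Disjoint U V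
    U#V = disjoint-⊆ {r′ = y ─ x} U⊆A V⊆B A#B

    C#U∪V : Disjoint C (U ∪ V)
    C#U∪V = disjoint-∪ {r = U} (disjoint-sym {p = U} U#C) (disjoint-⊆ {r′ = y ─ x} C⊆A V⊆B A#B)

    D#U∪V : Disjoint D (U ∪ V)
    D#U∪V = disjoint-∪ {r = U} (disjoint-sym {p = U} (disjoint-⊆ {r′ = y ─ x} U⊆A D⊆B A#B))
                               (disjoint-sym {p = V} V#D)

    ∣U∪V∣ : ∣ U ∪ V ∣ ≡ ∣ U ∣ + ∣ V ∣
    ∣U∪V∣ = ∣p∪q∣≡∣p∣+∣q∣ U V U#V

    pow-∪ : (E F W : Subset q) → Disjoint E F → Pow ∣ E ∪ (W ∩ F) ∣ ⇔ Pow (∣ E ∣ + ∣ W ∩ F ∣)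
    pow-∪ E F W E#F = subst-⇔ Pow (∣p∪q∣≡∣p∣+∣q∣ E (W ∩ F)
      λ i∈E i∈W∩F → E#F i∈E (p∩q⊆q W F i∈W∩F))

  halfMatching-sat : Holds (halfMatching P Q X Y) xs Xs ⇔ HalfMatching (∣ U ∣) (∣ V ∣) (∣ C ∣) (∣ D ∣)
  halfMatching-sat = isPow-sat (part P X Y) xs Xs ×-⇔ (small ×-⇔ transfer)
    where
    uᵗ = part (suc P) (suc X) (suc Y)
    vᵗ = part (suc Q) (suc Y) (suc X)
    cᵗ = rest (suc P) (suc X) (suc Y)
    dᵗ = rest (suc Q) (suc Y) (suc X)
    small = notDoubled-sat uᵗ cᵗ xs Xs
          ⟫ Π-cong (λ W → →-cong-⇔ (⇔-id _) (¬-cong-⇔ (pow-∪ U C W U#C)))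
          ⟫ ∀-sizes C (λ n → Pow n → ¬ Pow (∣ U ∣ + n))
    transfer = transfers-sat cᵗ dᵗ (uᵗ ⋃ vᵗ) xs Xs
             ⟫ Π-cong (λ W → →-cong-⇔ (pow-∪ C (U ∪ V) W C#U∪V) (pow-∪ D (U ∪ V) W D#U∪V))
             ⟫ ∀-sizes (U ∪ V) (λ n → Pow (∣ C ∣ + n) → Pow (∣ D ∣ + n))
             ⟫ subst-⇔ (λ m → ∀ n → n ≤ m → Pow (∣ C ∣ + n) → Pow (∣ D ∣ + n)) ∣U∪V∣

  isPow-parts-sat : Holds (isPow (part P X Y ⋃ part Q Y X)) xs Xs ⇔ Pow (∣ U ∣ + ∣ V ∣)
  isPow-parts-sat = isPow-sat (part P X Y ⋃ part Q Y X) xs Xs ⟫ subst-⇔ Pow ∣U∪V∣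

eqCard-sat : (X Y : Fin l) (xs : Vec (Fin q) k) (Xs : Vec (Subset q) l) →
             Holds (eqCard X Y) xs Xs ⇔ ∣ lookup Xs X ∣ ≡ ∣ lookup Xs Y ∣
eqCard-sat X Y xs Xs =
    (ext-⇔ (lookup Xs X) (lookup Xs Y) ⊎-⇔ ∃-cong λ p → ∃-cong λ r →
        isPow-parts-sat xs (r ∷ p ∷ Xs) (suc zero) zero (suc (suc X)) (suc (suc Y))
    ×-⇔ (halfMatching-sat xs (r ∷ p ∷ Xs) (suc zero) zero (suc (suc X)) (suc (suc Y))
    ×-⇔ halfMatching-sat xs (r ∷ p ∷ Xs) zero (suc zero) (suc (suc Y)) (suc (suc X))))
  ⟫ matching⇔∣∣≡ (lookup Xs X) (lookup Xs Y)

eqCardᵗ-sat : (s : Term k l) (t : Term k (suc l)) (xs : Vec (Fin q) k) (Xs : Vec (Subset q) l) →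
              let S = ⟦ s ⟧ xs Xs in
              Holds (eqCardᵗ s t) xs Xs ⇔ ∣ S ∣ ≡ ∣ ⟦ t ⟧ xs (S ∷ Xs) ∣
eqCardᵗ-sat s t xs Xs =
    letₛ-sat s (letₛ t (eqCard (suc zero) zero)) xs Xs
  ⟫ letₛ-sat t (eqCard (suc zero) zero) xs (⟦ s ⟧ xs Xs ∷ Xs)
  ⟫ eqCard-sat (suc zero) zero xs (⟦ t ⟧ xs (⟦ s ⟧ xs Xs ∷ Xs) ∷ ⟦ s ⟧ xs Xs ∷ Xs)

-- Correctness of the formula for addition.

add-sat : (x y z : Fin k) (xs : Vec (Fin q) k) (Xs : Vec (Subset q) l) →
          Holds (add x y z) xs Xs ⇔ toℕ (lookup xs x) + toℕ (lookup xs y) ≡ toℕ (lookup xs z)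
add-sat {q = q} x y z xs Xs = (⇔-id _ ×-⇔ sets) ⟫ mk⇔ fwd bwd
  where
  x′ y′ z′ : Fin q
  x′ = lookup xs x
  y′ = lookup xs y
  z′ = lookup xs z
  interval = initial z′ ─ initial y′
  sets = eqCardᵗ-sat (below x) (below z ∖ below y) xs Xs ⟫ subst-⇔ (_≡ ∣ interval ∣) (∣initial∣ x′)
  fwd : ¬ (z′ Fin.< y′) × toℕ x′ ≡ ∣ interval ∣ → toℕ x′ + toℕ y′ ≡ toℕ z′
  fwd (z≮y , eq) = trans (cong (_+ toℕ y′) (trans eq (∣initial─initial∣ y′ z′ (≮⇒≥ z≮y))))
                         (m∸n+n≡m (≮⇒≥ z≮y))
  bwd : toℕ x′ + toℕ y′ ≡ toℕ z′ → ¬ (z′ Fin.< y′) × toℕ x′ ≡ ∣ interval ∣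
  bwd eq = ≤⇒≯ y≤z , trans (sym (m+n∸n≡m (toℕ x′) (toℕ y′)))
                           (trans (cong (_∸ toℕ y′) eq) (sym (∣initial─initial∣ y′ z′ y≤z)))
    where
    y≤z : toℕ y′ ≤ toℕ z′
    y≤z = subst (toℕ y′ ≤_) eq (m≤n+m (toℕ y′) (toℕ x′))

-- Correctness of the formula for multiplication.

isZero-sat : (x : Fin k) (xs : Vec (Fin q) k) (Xs : Vec (Subset q) l) →
             Holds (isZero x) xs Xs ⇔ toℕ (lookup xs x) ≡ 0
isZero-sat x xs Xs with lookup xs x
... | zero  = mk⇔ (λ _ → refl) (λ _ _ ())
... | suc i = mk⇔ (λ h → contradiction z<s (h zero)) (λ ())

IsMultiples : ℕ → Subset q → Set
IsMultiples x S = ∀ i → i ∈ₛ S ⇔ x ∥ toℕ i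

isMultiples-sat : (x : Fin k) (S : Fin l) (xs : Vec (Fin q) k) (Xs : Vec (Subset q) l) →
                  0 < toℕ (lookup xs x) →
                  Holds (isMultiples x S) xs Xs ⇔ IsMultiples (toℕ (lookup xs x)) (lookup Xs S)
isMultiples-sat {q = q} x S xs Xs 0<x = mk⇔ fwd bwd
  where
  x′ = toℕ (lookup xs x)
  S′ = lookup Xs S

  base-sat : ∀ i → Holds {k = suc _} (isZero zero) (i ∷ xs) Xs ⇔ toℕ i ≡ 0
  base-sat i = isZero-sat zero (i ∷ xs) Xs

  step-sat : ∀ i j → Holds (add (suc zero) (suc (suc x)) zero) (j ∷ i ∷ xs) Xs ⇔ toℕ i + x′ ≡ toℕ j
  step-sat i j = add-sat (suc zero) (suc (suc x)) zero (j ∷ i ∷ xs) Xs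

  ∣⇔≡0 : ∀ {n} → n < x′ → x′ ∥ n ⇔ n ≡ 0
  ∣⇔≡0 {zero}  n<x = mk⇔ (λ _ → refl) (λ _ → x′ ∣0)
  ∣⇔≡0 {suc n} n<x = mk⇔ (λ x∣n → contradiction x∣n (>⇒∤ n<x)) (λ ())

  ∣-shift : ∀ n → x′ ∥ n ⇔ x′ ∥ n + x′
  ∣-shift n = mk⇔ (λ x∣n → ∣m∣n⇒∣m+n x∣n ∣-refl)
                  (λ x∣ → ∣m+n∣m⇒∣n (subst (x′ ∥_) (+-comm n x′) x∣) ∣-refl)

  fwd : Holds (isMultiples x S) xs Xs → IsMultiples x′ S′
  fwd (base , step) i = go i (<-wellFounded i)
    where
    -- Descent from i to i - x, which stays in the domain, until the base clause decides below x.
    go : ∀ i → Acc Fin._<_ i → i ∈ₛ S′ ⇔ x′ ∥ toℕ i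
    go i (acc rec) with toℕ i <? x′
    ... | yes i<x = let h = base i i<x in
      mk⇔ (to (base-sat i) ∘ proj₁ h) (proj₂ h ∘ from (base-sat i)) ⟫ ⇔-sym (∣⇔≡0 i<x)
    ... | no  i≮x =
      mk⇔ (proj₂ h) (proj₁ h) ⟫ go j (rec j<i) ⟫ ∣-shift (toℕ j) ⟫ subst-⇔ (x′ ∥_) j+x≡i
      where
      i∸x<i : toℕ i ∸ x′ < toℕ i
      i∸x<i = ∸-monoʳ-< 0<x (≮⇒≥ i≮x)
      j : Fin q
      j = fromℕ< (<-trans i∸x<i (toℕ<n i))
      toℕ-j : toℕ j ≡ toℕ i ∸ x′
      toℕ-j = toℕ-fromℕ< _
      j<i : j Fin.< i
      j<i = subst (_< toℕ i) (sym toℕ-j) i∸x<i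
      j+x≡i : toℕ j + x′ ≡ toℕ i
      j+x≡i = trans (cong (_+ x′) toℕ-j) (m∸n+n≡m (≮⇒≥ i≮x))
      h = step j i (from (step-sat j i) j+x≡i)

  bwd : IsMultiples x′ S′ → Holds (isMultiples x S) xs Xs
  bwd h =
      (λ i i<x → let e = h i ⟫ ∣⇔≡0 i<x ⟫ ⇔-sym (base-sat i) in to e , from e)
    , (λ i j s → let e = h i ⟫ ∣-shift (toℕ i) ⟫ subst-⇔ (x′ ∥_) (to (step-sat i j) s) ⟫ ⇔-sym (h j)
                 in to e , from e)

-- The multiples below m x are 0, x, ..., (m - 1) x; as z itself is excluded and 0 included, there
-- are m of them.
∣multiples-initial∣ : ∀ {x} (S : Subset q) (z : Fin q) (m : ℕ) → 0 < x → IsMultiples x S →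
                    toℕ z ≡ m * x → ∣ S ∩ initial z ∣ ≡ m
∣multiples-initial∣ {x = x} S z m 0<x mult z≡mx =
  ∣∣-enumeration _ m (_* x) (*-monoˡ-< x) (λ j<m → <-trans (bound j<m) (toℕ<n z)) λ i →
    ⇔-sym (∈-∩-⇔ S _) ⟫ (mult i ×-⇔ ∈-initial z i)
    ⟫ mk⇔ (λ { (divides j i≡jx , i<z) → j , *-cancelʳ-< x _ _ (subst₂ _<_ i≡jx z≡mx i<z) , i≡jx })
          (λ (j , j<m , i≡jx) → divides j i≡jx , subst (_< toℕ z) (sym i≡jx) (bound j<m))
  where
  instance
    x≢0 : NonZero x
    x≢0 = >-nonZero 0<x
  bound : ∀ {j} → j < m → j * x < toℕ z
  bound j<m = subst (_ <_) (sym z≡mx) (*-monoˡ-< x j<m)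

mul-sat : (x y z : Fin k) (xs : Vec (Fin q) k) (Xs : Vec (Subset q) l) →
          Holds (mul x y z) xs Xs ⇔ toℕ (lookup xs x) * toℕ (lookup xs y) ≡ toℕ (lookup xs z)
mul-sat {q = q} x y z xs Xs = mk⇔ fwd bwd
  where
  x′ y′ z′ : ℕ
  x′ = toℕ (lookup xs x)
  y′ = toℕ (lookup xs y)
  z′ = toℕ (lookup xs z)

  zero-sat = isZero-sat x xs Xs

  size-sat : ∀ S → Holds (eqCardᵗ (var zero ⋂ below z) (below y)) xs (S ∷ Xs)
                   ⇔ ∣ S ∩ initial (lookup xs z) ∣ ≡ y′
  size-sat S = eqCardᵗ-sat (var zero ⋂ below z) (below y) xs (S ∷ Xs)
             ⟫ subst-⇔ (_ ≡_) (∣initial∣ (lookup xs y))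

  fwd : Holds (mul x y z) xs Xs → x′ * y′ ≡ z′
  fwd (inj₁ (x≡0 , z≡0)) =
    trans (cong (_* y′) (to zero-sat x≡0)) (sym (to (isZero-sat z xs Xs) z≡0))
  fwd (inj₂ (x≢0 , S , multiples , z∈S , size))
    with 0<x ← n≢0⇒n>0 (x≢0 ∘ from zero-sat)
    with mult ← to (isMultiples-sat x zero xs (S ∷ Xs) 0<x) multiples
    -- Membership of z in S yields z = m x; counting the multiples below z then gives y = m.
    with divides m z≡mx ← to (mult (lookup xs z)) z∈S = begin
      x′ * y′  ≡⟨ cong (x′ *_) (trans (sym (to (size-sat S) size)) (∣multiples-initial∣ S _ m 0<x mult z≡mx)) ⟩
      x′ * m   ≡⟨ *-comm x′ m ⟩
      m * x′   ≡⟨ z≡mx ⟨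
      z′       ∎
    where open ≡-Reasoning

  bwd : x′ * y′ ≡ z′ → Holds (mul x y z) xs Xs
  bwd xy≡z with x′ ≟ 0
  ... | yes x≡0 = inj₁ (from zero-sat x≡0
                       , from (isZero-sat z xs Xs) (trans (sym xy≡z) (cong (_* y′) x≡0)))
  ... | no  x≢0 = inj₂ (x≢0 ∘ to zero-sat , S , from (isMultiples-sat x zero xs (S ∷ Xs) 0<x) mult
                       , from (mult (lookup xs z)) (divides y′ z≡yx)
                       , from (size-sat S) (∣multiples-initial∣ S _ y′ 0<x mult z≡yx))
    where
    0<x = n≢0⇒n>0 x≢0
    z≡yx = trans (sym xy≡z) (*-comm x′ y′)
    S : Subset q
    S = comprehension λ i → x′ ∣? toℕ i
    mult : IsMultiples x′ S
    mult = ∈-comprehension λ i → x′ ∣? toℕ i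

proposition4p8 : FiniteDefinable𝓕 CardIsPowerOf2 EqCard
    × FiniteDefinableℕ CardIsPowerOf2 +-Graph
    × FiniteDefinableℕ CardIsPowerOf2 ×-Graph
proposition4p8 =
    (eqCard zero (suc zero) , λ { q _ Xs@(X ∷ Y ∷ []) →
      eqCard-sat zero (suc zero) [] Xs
      ⟫ mk⇔ (λ eq → trans (card-embed X) (trans eq (sym (card-embed Y))))
            (λ eq → trans (sym (card-embed X)) (trans eq (card-embed Y))) })
  , (add zero (suc zero) (suc (suc zero)) , λ { q _ xs@(_ ∷ _ ∷ _ ∷ []) →
      add-sat zero (suc zero) (suc (suc zero)) xs [] })
  , (mul zero (suc zero) (suc (suc zero)) , λ { q _ xs@(_ ∷ _ ∷ _ ∷ []) →
      mul-sat zero (suc zero) (suc (suc zero)) xs [] })
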